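{- Let $s_n$ be the number of labeled split graphs on $n$ vertices and let $u_n$ be the number of labeled unbalanced split graphs on $n$ vertices. Then almost all labeled split graphs are balanced: $$\lim_{n\to\infty}\frac{u_n}{s_n}=0.$$
   Context: Graphs are finite and simple. A split graph is a graph whose vertices can be partitioned into two (possibly empty) sets $K$ and $S$ such that $K$ is a clique and $S$ is a stable (independent) set; such an ordered partition $(K,S)$ is called a $KS$-partition. A split graph is balanced if it has a unique $KS$-partition, and unbalanced otherwise. Labeled graphs on $n$ vertices are graphs with vertex set $\{1,\dots,n\}$. -}

module Defs where

open import Data.Bool.Base using (Bool; true; false; T)
open import Data.Bool.Properties using (T?) renaming (_≟_ to _≟ᵇ_)
open import Data.Empty using (⊥-elim)
open import Data.Fin.Base using (Fin)
open import Data.Fin.Properties using (all?) renaming (_≟_ to _≟ᶠ_)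
open import Data.Fin.Subset using (Subset; _∈_; _∪_; _∩_; ⊤; ⊥)
open import Data.Fin.Subset.Properties using (_∈?_; anySubset?; ∪-identityˡ; ∩-zeroˡ; ∉⊥)
open import Data.List.Base using (List; []; _∷_; length; map; filter; cartesianProductWith)
open import Data.List.Membership.Propositional renaming (_∈_ to _∈ˡ_) using ()
open import Data.List.Membership.Propositional.Properties
  using (∈-filter⁺; ∈-map⁻; ∈-cartesianProductWith⁺; ∈-length)
open import Data.List.Relation.Unary.All using ([]; _∷_)
open import Data.List.Relation.Unary.AllPairs using ([]; _∷_)
open import Data.List.Relation.Unary.Any using (here; there)
open import Data.List.Relation.Unary.Unique.Propositional using (Unique)
open import Data.List.Relation.Unary.Unique.Propositional.Properties
  using (cartesianProductWith⁺; map⁻; filter⁺)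
open import Data.Nat.Base using (ℕ; zero; suc; NonZero; _≥_; >-nonZero)
open import Data.Product using (_×_; _,_; ∃; ∃-syntax; ∃!; uncurry)
open import Data.Rational.Base using (ℚ; 0ℚ; _<_; _-_; ∣_∣)
open import Data.Vec.Base using (Vec; []; _∷_; lookup; replicate)
open import Data.Vec.Properties using (∷-injective; ≡-dec; lookup-replicate)
open import Level using (Level)
open import Relation.Binary.PropositionalEquality
  using (_≡_; _≢_; refl; sym; trans; cong; cong₂; subst)
open import Relation.Nullary.Decidable
  using (Dec; yes; no; ¬?; map′; _×-dec_; _→-dec_;
         decidable-stable; recompute)
open import Relation.Nullary.Negation using (¬_)
open import Relation.Unary using (Pred; Decidable)

private
  variable
    a p : Level
    A B : Set a
    n   : ℕ

Matrix : ℕ → Set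
Matrix n = Vec (Vec Bool n) n

entry : Matrix n → Fin n → Fin n → Bool
entry M i j = lookup (lookup M i) j

IsSimple : Pred (Matrix n) _
IsSimple M = (∀ i j → entry M i j ≡ entry M j i) × (∀ i → entry M i i ≡ false)

isSimple? : Decidable (IsSimple {n})
isSimple? M = all? (λ i → all? λ j → entry M i j ≟ᵇ entry M j i)
        ×-dec all? (λ i → entry M i i ≟ᵇ false)

-- The vertex set {1,…,n} is Fin n.  The simplicity proof is irrelevant, so
-- that _≡_ on graphs is equality of labeled graphs (not isomorphism).
record Graph (n : ℕ) : Set where
  constructor graph
  field
    matrix    : Matrix n
    .isSimple : IsSimple matrix

open Graph public using (matrix)

Adj : Graph n → Fin n → Fin n → Set
Adj G i j = T (entry (matrix G) i j)

adj? : (G : Graph n) → ∀ i j → Dec (Adj G i j)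
adj? G i j = T? (entry (matrix G) i j)

IsClique : Graph n → Pred (Subset n) _
IsClique G K = ∀ i j → i ∈ K → j ∈ K → i ≢ j → Adj G i j

IsStable : Graph n → Pred (Subset n) _
IsStable G S = ∀ i j → i ∈ S → j ∈ S → ¬ Adj G i j

IsPartition : Subset n → Subset n → Set
IsPartition K S = K ∪ S ≡ ⊤ × K ∩ S ≡ ⊥

IsKSPartition : Graph n → Pred (Subset n × Subset n) _
IsKSPartition G (K , S) = IsPartition K S × IsClique G K × IsStable G S

IsSplit : Pred (Graph n) _
IsSplit G = ∃ (IsKSPartition G)

IsBalanced : Pred (Graph n) _
IsBalanced G = ∃! _≡_ (IsKSPartition G)

IsUnbalanced : Pred (Graph n) _
IsUnbalanced G = IsSplit G × ¬ IsBalanced G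

isKSPartition? : (G : Graph n) → Decidable (IsKSPartition G)
isKSPartition? G (K , S) =
  (≡-dec _≟ᵇ_ (K ∪ S) ⊤ ×-dec ≡-dec _≟ᵇ_ (K ∩ S) ⊥)
  ×-dec all? (λ i → all? λ j →
          (i ∈? K) →-dec (j ∈? K) →-dec ¬? (i ≟ᶠ j) →-dec adj? G i j)
  ×-dec all? (λ i → all? λ j →
          (i ∈? S) →-dec (j ∈? S) →-dec ¬? (adj? G i j))

anyPair? : {P : Pred (Subset n × Subset n) p} → Decidable P → Dec (∃ P)
anyPair? P? = map′ (λ (K , S , x) → (K , S) , x) (λ ((K , S) , x) → K , S , x)
  (anySubset? λ K → anySubset? λ S → P? (K , S))

allPairs? : {P : Pred (Subset n × Subset n) p} → Decidable P → Dec (∀ {x} → P x)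
allPairs? P? = map′
  (λ none {x} → decidable-stable (P? x) λ ¬Px → none (x , ¬Px))
  (λ every (x , ¬Px) → ¬Px every)
  (¬? (anyPair? λ x → ¬? (P? x)))

isSplit? : Decidable (IsSplit {n})
isSplit? G = anyPair? (isKSPartition? G)

isBalanced? : Decidable (IsBalanced {n})
isBalanced? G = anyPair? λ x → isKSPartition? G x
  ×-dec allPairs? λ y → isKSPartition? G y →-dec x ≟ y
  where
  _≟_ : (x y : Subset n × Subset n) → Dec (x ≡ y)
  (K , S) ≟ (K′ , S′) = map′ (uncurry (cong₂ _,_)) (λ { refl → refl , refl })
    (≡-dec _≟ᵇ_ K K′ ×-dec ≡-dec _≟ᵇ_ S S′)

isUnbalanced? : Decidable (IsUnbalanced {n})
isUnbalanced? G = isSplit? G ×-dec ¬? (isBalanced? G)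

vectors : List A → ∀ n → List (Vec A n)
vectors xs zero    = [] ∷ []
vectors xs (suc n) = cartesianProductWith _∷_ xs (vectors xs n)

matrices : ∀ n → List (Matrix n)
matrices n = vectors (vectors (false ∷ true ∷ []) n) n

collect : {P : Pred A p} → Decidable P → (∀ x → P x → B) → List A → List B
collect P? f []       = []
collect P? f (x ∷ xs) with P? x
... | yes px = f x px ∷ collect P? f xs
... | no  _  = collect P? f xs

-- Every labeled graph on n vertices exactly once: see graphs-complete and
-- graphs-unique below.
graphs : ∀ n → List (Graph n)
graphs n = collect isSimple? (λ M simple → graph M simple) (matrices n)

matrix-injective : {G H : Graph n} → matrix G ≡ matrix H → G ≡ H
matrix-injective refl = refl

vectors-complete : {xs : List A} → (∀ x → x ∈ˡ xs) → (v : Vec A n) → v ∈ˡ vectors xs n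
vectors-complete all∈ []      = here refl
vectors-complete all∈ (x ∷ v) = ∈-cartesianProductWith⁺ _∷_ (all∈ x) (vectors-complete all∈ v)

vectors-unique : {xs : List A} → Unique xs → ∀ n → Unique (vectors xs n)
vectors-unique xs! zero    = [] ∷ []
vectors-unique xs! (suc n) = cartesianProductWith⁺ _∷_ ∷-injective xs! (vectors-unique xs! n)

matrices-complete : (M : Matrix n) → M ∈ˡ matrices n
matrices-complete = vectors-complete (vectors-complete λ where
  false → here refl
  true  → there (here refl))

matrices-unique : ∀ n → Unique (matrices n)
matrices-unique n = vectors-unique (vectors-unique (((λ ()) ∷ []) ∷ [] ∷ []) n) n

map-collect : {P : Pred A p} (P? : Decidable P) {f : ∀ x → P x → B} {g : B → A} →
              (∀ x px → g (f x px) ≡ x) → ∀ xs → map g (collect P? f xs) ≡ filter P? xs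
map-collect P? gf []       = refl
map-collect P? gf (x ∷ xs) with P? x
... | yes px = cong₂ _∷_ (gf x px) (map-collect P? gf xs)
... | no  _  = map-collect P? gf xs

map-matrix : ∀ n → map matrix (graphs n) ≡ filter isSimple? (matrices n)
map-matrix n = map-collect isSimple? (λ _ _ → refl) (matrices n)

graphs-complete : (G : Graph n) → G ∈ˡ graphs n
graphs-complete {n} (graph M simple)
  with ∈-map⁻ matrix (subst (M ∈ˡ_) (sym (map-matrix n))
         (∈-filter⁺ isSimple? (matrices-complete M) (recompute (isSimple? M) simple)))
... | H , H∈ , eq = subst (_∈ˡ graphs n) (sym (matrix-injective eq)) H∈

graphs-unique : ∀ n → Unique (graphs n)
graphs-unique n = map⁻ (subst Unique (sym (map-matrix n))
  (filter⁺ isSimple? (matrices-unique n)))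

count : {P : Pred (Graph n) p} → Decidable P → ℕ
count {n} P? = length (filter P? (graphs n))

s : ℕ → ℕ
s n = count (isSplit? {n})

u : ℕ → ℕ
u n = count (isUnbalanced? {n})

entry-false : ∀ n (i j : Fin n) → entry (replicate n (replicate n false)) i j ≡ false
entry-false n i j =
  trans (cong (λ r → lookup r j) (lookup-replicate i _)) (lookup-replicate j false)

edgeless : ∀ n → Graph n
edgeless n = graph (replicate n (replicate n false))
  ((λ i j → trans (entry-false n i j) (sym (entry-false n j i))) , λ i → entry-false n i i)

edgeless-isSplit : ∀ n → IsSplit (edgeless n)
edgeless-isSplit n = (⊥ , ⊤) , (∪-identityˡ ⊤ , ∩-zeroˡ ⊤)
  , (λ i j i∈⊥ → ⊥-elim (∉⊥ i∈⊥))
  , λ i j _ _ → subst T (entry-false n i j)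

s-nonZero : ∀ n → NonZero (s n)
s-nonZero n = >-nonZero (∈-length
  (∈-filter⁺ isSplit? (graphs-complete (edgeless n)) (edgeless-isSplit n)))

-- Testing only rational ε > 0 is equivalent to testing all real ε > 0.
Lim : (ℕ → ℚ) → ℚ → Set
Lim x l = ∀ ε → 0ℚ < ε → ∃[ N ] ∀ n → n ≥ N → ∣ x n - l ∣ < ε

{-# OPTIONS --safe #-}
module Submission where

-- An unbalanced split graph has a swing vertex v: some clique K ∌ v whose
-- complement is stable is exactly the neighbourhood of v.  Put v on the side
-- opposite to the larger of the two remaining parts and choose its neighbours in
-- that larger part freely: this gives at least 2^m split graphs if 2m ≤ n.  The
-- original graph and the choice made can be recovered from v, its new side, and the
-- KS-partition.  The KS-partitions of one graph differ from each other in at most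
-- two vertices, so each split graph arises at most (2n)³ times, whence
-- u n * 2^m ≤ s n * (2n)³.

open import Defs
open import Data.Bool.Base using (Bool; true; false; T; not)
open import Data.Bool.Properties using (T-≡; ¬-not) renaming (_≟_ to _≟ᵇ_)
open import Data.Fin.Base using (Fin; zero; suc)
open import Data.Fin.Properties using (any?) renaming (_≟_ to _≟ᶠ_)
open import Data.Fin.Subset using (Subset; _∈_; ∁; ⊥; ∣_∣)
open import Data.Fin.Subset.Properties using (p∪∁p≡⊤; ∩-inverseʳ; ∣∁p∣≡n∸∣p∣)
open import Data.Integer.Base as ℤ using (+_; -[1+_]; +<+)
import Data.Integer.Properties as ℤ
open import Data.List.Base
  using (List; []; _∷_; _++_; length; map; filter; cartesianProductWith; cartesianProduct; allFin)
open import Data.List.Membership.Propositional using () renaming (_∈_ to _∈ˡ_)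
open import Data.List.Membership.Propositional.Properties
  using (∈-∃++; ∈-++⁻; ∈-++⁺ˡ; ∈-++⁺ʳ; ∈-filter⁺; ∈-filter⁻; ∈-map⁺;
         ∈-cartesianProduct⁺; ∈-cartesianProduct⁻; ∈-allFin)
open import Data.List.Properties using (length-++; length-map; length-++-sucʳ; length-tabulate)
open import Data.List.Relation.Binary.Subset.Propositional using (_⊆_)
import Data.List.Relation.Unary.All as All
open import Data.List.Relation.Unary.AllPairs using ([]; _∷_)
open import Data.List.Relation.Unary.Any using (here; there)
open import Data.List.Relation.Unary.Unique.Propositional using (Unique)
import Data.List.Relation.Unary.Unique.Propositional.Properties as Unique
open import Data.Nat.Base renaming (_/_ to _div_)
open import Data.Nat.DivMod using (m≡m%n+[m/n]*n; m%n<n; m/n*n≤m; /-monoˡ-≤; m*n/n≡m)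
open import Data.Nat.Properties
open import Data.Nat.Solver using (module +-*-Solver)
open import Data.Product.Base using (_×_; _,_; proj₁; proj₂; ∃; ∃-syntax)
open import Data.Rational.Base as ℚ using (mkℚ; 0ℚ; _/_; ↧ₙ_)
import Data.Rational.Properties as ℚ
import Data.Rational.Unnormalised.Base as ℚᵘ
import Data.Rational.Unnormalised.Properties as ℚᵘ
open import Data.Sum.Base using (inj₁; inj₂)
open import Data.Vec.Base using (Vec; []; _∷_; lookup; tail; tabulate; replicate; _[_]≔_)
open import Data.Vec.Properties
  using (tabulate∘lookup; tabulate-cong; lookup∘tabulate; lookup∘update; lookup∘update′;
         []≔-idempotent; []≔-lookup; lookup-map; lookup⇒[]=; []=⇒lookup)
open import Function.Base using (_∘_)
open import Function.Bundles using (module Equivalence)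
open import Relation.Binary.PropositionalEquality
open import Relation.Nullary
  using (Dec; yes; no; ¬?; contradiction; decidable-stable; recompute; _×-dec_)

private
  variable
    A B C : Set
    m n   : ℕ

-- Counting with duplicate-free lists and boolean words.

length-cartesianProductWith : (f : A → B → C) (xs : List A) (ys : List B) →
  length (cartesianProductWith f xs ys) ≡ length xs * length ys
length-cartesianProductWith f []       ys = refl
length-cartesianProductWith f (x ∷ xs) ys = trans (length-++ (map (f x) ys))
  (cong₂ _+_ (length-map (f x) ys) (length-cartesianProductWith f xs ys))

-- Pigeonhole: deleting one occurrence of the head from `ys` keeps every element of the tail, since
-- these all differ from the head.
unique-⊆⇒length≤ : {xs ys : List A} → Unique xs → xs ⊆ ys → length xs ≤ length ys
unique-⊆⇒length≤ []           sub = z≤n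
unique-⊆⇒length≤ (x∉xs ∷ xs!) sub with as , bs , refl ← ∈-∃++ (sub (here refl)) =
  subst (_ ≤_) (sym (length-++-sucʳ as _ bs)) (s≤s (unique-⊆⇒length≤ xs! sub′))
  where
  sub′ : _ ⊆ as ++ bs
  sub′ y∈xs with ∈-++⁻ as (sub (there y∈xs))
  ... | inj₁ y∈as         = ∈-++⁺ˡ y∈as
  ... | inj₂ (here refl)  = contradiction refl (All.lookup x∉xs y∈xs)
  ... | inj₂ (there y∈bs) = ∈-++⁺ʳ as y∈bs

length-vectors : (xs : List A) → ∀ n → length (vectors xs n) ≡ length xs ^ n
length-vectors xs zero    = refl
length-vectors xs (suc n) = trans (length-cartesianProductWith _∷_ xs (vectors xs n))
  (cong (length xs *_) (length-vectors xs n))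

bools : List Bool
bools = false ∷ true ∷ []

bools-complete : ∀ b → b ∈ˡ bools
bools-complete false = here refl
bools-complete true  = there (here refl)

bools-unique : Unique bools
bools-unique = ((λ ()) All.∷ All.[]) ∷ All.[] ∷ []

lookup-ext : {xs ys : Vec A n} → (∀ i → lookup xs i ≡ lookup ys i) → xs ≡ ys
lookup-ext eq = trans (sym (tabulate∘lookup _)) (trans (tabulate-cong eq) (tabulate∘lookup _))

-- Storing a word in selected positions of a row.

overwrite : Subset n → Vec Bool n → Vec Bool m → Vec Bool n
overwrite []          []       w       = []
overwrite (false ∷ X) (b ∷ bs) w       = b ∷ overwrite X bs w
overwrite (true ∷ X)  (b ∷ bs) []      = b ∷ bs
overwrite (true ∷ X)  (b ∷ bs) (c ∷ w) = c ∷ overwrite X bs w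

extract : Subset n → Vec Bool n → ∀ m → Vec Bool m
extract []          []       m       = replicate m false
extract (false ∷ X) (b ∷ bs) m       = extract X bs m
extract (true ∷ X)  (b ∷ bs) zero    = []
extract (true ∷ X)  (b ∷ bs) (suc m) = b ∷ extract X bs m

-- A word shorter than `∣ X ∣` leaves the later selected positions as they were, and `extract` stops
-- after `m` of them. The bound keeps the word from being cut off and `extract` from padding with
-- `false`.
extract-overwrite : (X : Subset n) (bs : Vec Bool n) (w : Vec Bool m) → m ≤ ∣ X ∣ →
  extract X (overwrite X bs w) m ≡ w
extract-overwrite []          []       []      m≤       = refl
extract-overwrite (false ∷ X) (b ∷ bs) w       m≤       = extract-overwrite X bs w m≤
extract-overwrite (true ∷ X)  (b ∷ bs) []      m≤       = refl
extract-overwrite (true ∷ X)  (b ∷ bs) (c ∷ w) (s≤s m≤) =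
  cong (c ∷_) (extract-overwrite X bs w m≤)

lookup-overwrite : (X : Subset n) (bs : Vec Bool n) (w : Vec Bool m) → ∀ i →
  lookup X i ≡ false → lookup (overwrite X bs w) i ≡ lookup bs i
lookup-overwrite (false ∷ X) (b ∷ bs) w       zero    Xi = refl
lookup-overwrite (false ∷ X) (b ∷ bs) w       (suc i) Xi = lookup-overwrite X bs w i Xi
lookup-overwrite (true ∷ X)  (b ∷ bs) []      (suc i) Xi = refl
lookup-overwrite (true ∷ X)  (b ∷ bs) (c ∷ w) (suc i) Xi = lookup-overwrite X bs w i Xi

-- Replacing the neighbourhood of one vertex.

edge : Graph n → Fin n → Fin n → Bool
edge G = entry (matrix G)

edge-sym : (G : Graph n) → ∀ i j → edge G i j ≡ edge G j i
edge-sym (graph M simple) = proj₁ (recompute (isSimple? M) simple)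

edge-irrefl : (G : Graph n) → ∀ i → edge G i i ≡ false
edge-irrefl (graph M simple) = proj₂ (recompute (isSimple? M) simple)

edge-ext : {G H : Graph n} → (∀ i j → edge G i j ≡ edge H i j) → G ≡ H
edge-ext eq = matrix-injective (lookup-ext λ i → lookup-ext (eq i))

-- The diagonal entry at `v` is forced to `false`, so a simple matrix stays simple even if `r` marks
-- `v` itself.
rewireEntry : Fin n → Vec Bool n → Matrix n → Fin n → Fin n → Bool
rewireEntry v r M i j with i ≟ᶠ v | j ≟ᶠ v
... | yes _ | yes _ = false
... | yes _ | no  _ = lookup r j
... | no  _ | yes _ = lookup r i
... | no  _ | no  _ = entry M i j

rewireMatrix : Fin n → Vec Bool n → Matrix n → Matrix n
rewireMatrix v r M = tabulate λ i → tabulate (rewireEntry v r M i)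

entry-rewire : (v : Fin n) (r : Vec Bool n) (M : Matrix n) → ∀ i j →
  entry (rewireMatrix v r M) i j ≡ rewireEntry v r M i j
entry-rewire v r M i j = trans
  (cong (λ row → lookup row j) (lookup∘tabulate (λ i → tabulate (rewireEntry v r M i)) i))
  (lookup∘tabulate (rewireEntry v r M i) j)

rewireMatrix-isSimple : (v : Fin n) (r : Vec Bool n) (M : Matrix n) → IsSimple M →
  IsSimple (rewireMatrix v r M)
rewireMatrix-isSimple v r M (symm , irr) =
  (λ i j → trans (entry-rewire v r M i j) (trans (symm′ i j) (sym (entry-rewire v r M j i)))) ,
  (λ i → trans (entry-rewire v r M i i) (irr′ i))
  where
  symm′ : ∀ i j → rewireEntry v r M i j ≡ rewireEntry v r M j i
  symm′ i j with i ≟ᶠ v | j ≟ᶠ v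
  ... | yes _ | yes _ = refl
  ... | yes _ | no  _ = refl
  ... | no  _ | yes _ = refl
  ... | no  _ | no  _ = symm i j
  irr′ : ∀ i → rewireEntry v r M i i ≡ false
  irr′ i with i ≟ᶠ v
  ... | yes _ = refl
  ... | no  _ = irr i

rewire : Fin n → Vec Bool n → Graph n → Graph n
rewire v r (graph M simple) = graph (rewireMatrix v r M) (rewireMatrix-isSimple v r M simple)

edge-rewire-row : (v : Fin n) (r : Vec Bool n) (G : Graph n) → ∀ {j} → j ≢ v →
  edge (rewire v r G) v j ≡ lookup r j
edge-rewire-row v r (graph M _) {j} j≢v rewrite entry-rewire v r M v j with v ≟ᶠ v | j ≟ᶠ v
... | yes _   | yes j≡v = contradiction j≡v j≢v
... | yes _   | no  _   = refl
... | no  v≢v | _       = contradiction refl v≢v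

edge-rewire-other : (v : Fin n) (r : Vec Bool n) (G : Graph n) → ∀ {i j} → i ≢ v → j ≢ v →
  edge (rewire v r G) i j ≡ edge G i j
edge-rewire-other v r (graph M _) {i} {j} i≢v j≢v rewrite entry-rewire v r M i j
  with i ≟ᶠ v | j ≟ᶠ v
... | yes i≡v | _       = contradiction i≡v i≢v
... | no  _   | yes j≡v = contradiction j≡v j≢v
... | no  _   | no  _   = refl

matrix-rewire-row : (v : Fin n) (r : Vec Bool n) (G : Graph n) → lookup r v ≡ false →
  lookup (matrix (rewire v r G)) v ≡ r
matrix-rewire-row v r G rv = lookup-ext eq
  where
  eq : ∀ j → edge (rewire v r G) v j ≡ lookup r j
  eq j with j ≟ᶠ v
  ... | yes refl = trans (edge-irrefl (rewire v r G) v) (sym rv)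
  ... | no  j≢v  = edge-rewire-row v r G j≢v

-- Rewiring touches only the row and column of `v`, and by symmetry the old row determines both.
rewire-restore : (v : Fin n) (r : Vec Bool n) (G : Graph n) →
  rewire v (lookup (matrix G) v) (rewire v r G) ≡ G
rewire-restore v r G = edge-ext eq
  where
  H = rewire v r G
  row = lookup (matrix G) v
  eq : ∀ i j → edge (rewire v row H) i j ≡ edge G i j
  eq i j with i ≟ᶠ v | j ≟ᶠ v
  ... | yes refl | yes refl = trans (edge-irrefl (rewire v row H) v) (sym (edge-irrefl G v))
  ... | yes refl | no  j≢v  = edge-rewire-row v row H j≢v
  ... | no  i≢v  | yes refl = trans (edge-sym (rewire v row H) i v)
                                (trans (edge-rewire-row v row H i≢v) (edge-sym G v i))
  ... | no  i≢v  | no  j≢v  = trans (edge-rewire-other v row H i≢v j≢v)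
                                (edge-rewire-other v r G i≢v j≢v)

-- KS-partitions represented by their clique part.

-- The KS-partition (K , ∁ K), in one clause: both parts are homogeneous, and
-- membership in K says how.
Splits : Subset n → Graph n → Set
Splits K G = ∀ {i j} → i ≢ j → lookup K i ≡ lookup K j → edge G i j ≡ lookup K i

splits⇒isKSPartition : (G : Graph n) (K : Subset n) → Splits K G → IsKSPartition G (K , ∁ K)
splits⇒isKSPartition G K sp = (p∪∁p≡⊤ K , ∩-inverseʳ K) , clique , stable
  where
  clique : IsClique G K
  clique i j i∈K j∈K i≢j = Equivalence.from T-≡ (trans (sp i≢j
    (trans ([]=⇒lookup i∈K) (sym ([]=⇒lookup j∈K)))) ([]=⇒lookup i∈K))
  outside : ∀ i → lookup (∁ K) i ≡ true → lookup K i ≡ false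
  outside i eq with lookup K i | trans (sym (lookup-map i not K)) eq
  ... | false | _ = refl
  stable : IsStable G (∁ K)
  stable i j i∈S j∈S adj with i ≟ᶠ j
  ... | yes refl = subst T (edge-irrefl G i) adj
  ... | no  i≢j  = subst T (trans (sp i≢j (trans Ki (sym Kj))) Ki) adj
    where
    Ki = outside i ([]=⇒lookup i∈S)
    Kj = outside j ([]=⇒lookup j∈S)

isPartition⇒≡∁ : (K S : Subset n) → IsPartition K S → S ≡ ∁ K
isPartition⇒≡∁ []          []          _           = refl
isPartition⇒≡∁ (false ∷ K) (false ∷ S) (() , _)
isPartition⇒≡∁ (false ∷ K) (true ∷ S)  (∪≡ , ∩≡) =
  cong (true ∷_) (isPartition⇒≡∁ K S (cong tail ∪≡ , cong tail ∩≡))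
isPartition⇒≡∁ (true ∷ K)  (false ∷ S) (∪≡ , ∩≡) =
  cong (false ∷_) (isPartition⇒≡∁ K S (cong tail ∪≡ , cong tail ∩≡))
isPartition⇒≡∁ (true ∷ K)  (true ∷ S)  (_ , ())

isKSPartition⇒splits : (G : Graph n) (K S : Subset n) → IsKSPartition G (K , S) → Splits K G
isKSPartition⇒splits G K S (part , clique , stable) {i} {j} i≢j Ki≡Kj
  with isPartition⇒≡∁ K S part | lookup K i in Ki
... | refl | true  = Equivalence.to T-≡
  (clique i j (lookup⇒[]= i K Ki) (lookup⇒[]= j K (sym Ki≡Kj)) i≢j)
... | refl | false = ¬-not λ adj → stable i j (inside i Ki) (inside j (sym Ki≡Kj))
                                     (Equivalence.from T-≡ adj)
  where
  inside : ∀ i → lookup K i ≡ false → i ∈ ∁ K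
  inside i Ki = lookup⇒[]= i (∁ K) (trans (lookup-map i not K) (cong not Ki))

-- This choice depends on the graph alone, so `decode` can recompute it. `⊥` is a dummy value for
-- graphs that are not split.
cliquePart : Graph n → Subset n
cliquePart G with isSplit? G
... | yes ((K , _) , _) = K
... | no  _             = ⊥

cliquePart-splits : (G : Graph n) → IsSplit G → Splits (cliquePart G) G
cliquePart-splits G split with isSplit? G
... | yes ((K , S) , ks) = isKSPartition⇒splits G K S ks
... | no  ¬split         = contradiction split ¬split

-- Swing vertices of unbalanced split graphs.

-- A swing vertex v, placed on the stable side of a KS-partition: its
-- neighbourhood is the whole clique.
IsSwing : Graph n → Subset n → Fin n → Set
IsSwing G K v = Splits K G × lookup (matrix G) v ≡ K

isSwing⇒∉ : (G : Graph n) (K : Subset n) {v : Fin n} → IsSwing G K v → lookup K v ≡ false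
isSwing⇒∉ G K {v} (_ , row) = trans (sym (cong (λ r → lookup r v) row)) (edge-irrefl G v)

-- Split on whether `v` has a neighbour outside `K`. If so, that neighbour is a swing vertex for
-- `K`; if not, `v` becomes one once it is moved to the stable side.
∈∖⇒swing : (G : Graph n) (K K′ : Subset n) → Splits K G → Splits K′ G →
  (v : Fin n) → lookup K v ≡ true → lookup K′ v ≡ false → ∃[ L ] ∃ (IsSwing G L)
∈∖⇒swing G K K′ sp sp′ v Kv K′v
  with any? (λ x → (lookup K x ≟ᵇ false) ×-dec (edge G v x ≟ᵇ true))
-- Being adjacent to `v`, which is outside `K′`, the vertex `x` must be in `K′`. So is all of `K`
-- except `v`; hence `x` is adjacent to the whole of `K`, and to nothing outside it by stability.
... | yes (x , Kx , vx) = K , x , sp , lookup-ext row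
  where
  x≢v : x ≢ v
  x≢v refl with trans (sym Kv) Kx
  ... | ()
  K′x : lookup K′ x ≡ true
  K′x = ¬-not λ K′x → contradiction
    (trans (sym vx) (trans (sp′ (x≢v ∘ sym) (trans K′v (sym K′x))) K′v)) λ ()
  row : ∀ j → edge G x j ≡ lookup K j
  row j with j ≟ᶠ x | j ≟ᶠ v | lookup K j in Kj
  ... | yes refl | _        | true  = contradiction (trans (sym Kj) Kx) λ ()
  ... | yes refl | _        | false = edge-irrefl G j
  ... | no  j≢x  | _        | false = trans (sp (j≢x ∘ sym) (trans Kx (sym Kj))) Kx
  ... | no  j≢x  | yes refl | true  = trans (edge-sym G x j) vx
  ... | no  j≢x  | no  j≢v  | true  = trans (sp′ (j≢x ∘ sym) (trans K′x (sym K′j))) K′x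
    where
    -- If `j` were outside `K′`, then `j` and `v` would be non-adjacent there, yet adjacent as
    -- members of `K`.
    K′j : lookup K′ j ≡ true
    K′j = ¬-not λ K′j → contradiction
      (trans (sym (trans (sp j≢v (trans Kj (sym Kv))) Kj))
             (trans (sp′ j≢v (trans K′j (sym K′v))) K′j)) λ ()
-- Every neighbour of `v` is in `K`, and `v` is adjacent to the rest of `K`, so its row is `K`
-- without `v`.
... | no none = L , v , splitsL , lookup-ext row
  where
  L = K [ v ]≔ false
  Lv : lookup L v ≡ false
  Lv = lookup∘update v K false
  L≢ : ∀ {j} → j ≢ v → lookup L j ≡ lookup K j
  L≢ j≢v = lookup∘update′ j≢v K false
  row : ∀ j → edge G v j ≡ lookup L j
  row j with j ≟ᶠ v
  ... | yes refl = trans (edge-irrefl G v) (sym Lv)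
  ... | no  j≢v  = trans row′ (sym (L≢ j≢v))
    where
    row′ : edge G v j ≡ lookup K j
    row′ with lookup K j in Kj
    ... | true  = trans (sp (j≢v ∘ sym) (trans Kv (sym Kj))) Kv
    ... | false = ¬-not λ vj → none (j , Kj , vj)
  splitsL : Splits L G
  splitsL {i} {j} i≢j Li≡Lj with i ≟ᶠ v | j ≟ᶠ v
  ... | yes refl | _        = trans (row j) (sym Li≡Lj)
  ... | no  _    | yes refl = trans (edge-sym G i v) (row i)
  ... | no  i≢v  | no  j≢v  = trans
    (sp i≢j (trans (sym (L≢ i≢v)) (trans Li≡Lj (L≢ j≢v)))) (sym (L≢ i≢v))

-- Stable parts are complements of clique parts, so a second KS-partition differs from the first in
-- its clique part. At a vertex of difference, the two are ordered so that this vertex leaves the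
-- first clique.
unbalanced⇒swing : (G : Graph n) → IsUnbalanced G → ∃[ K ] ∃ (IsSwing G K)
unbalanced⇒swing G (((K , S) , ks) , ¬bal)
  with anyPair? (λ y → isKSPartition? G y ×-dec
                       any? (λ v → ¬? (lookup K v ≟ᵇ lookup (proj₁ y) v)))
... | no none = contradiction ((K , S) , ks , λ {y} → unique y) ¬bal
  where
  unique : ∀ y → IsKSPartition G y → (K , S) ≡ y
  unique (K′ , S′) ks′ with K≡K′ ← lookup-ext (λ v → decidable-stable
    (lookup K v ≟ᵇ lookup K′ v) λ K≢K′ → none ((K′ , S′) , ks′ , v , K≢K′)) =
    cong₂ _,_ K≡K′ (trans (isPartition⇒≡∁ K S (proj₁ ks))
      (trans (cong ∁ K≡K′) (sym (isPartition⇒≡∁ K′ S′ (proj₁ ks′)))))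
... | yes ((K′ , S′) , ks′ , v , K≢K′) with lookup K v in Kv | lookup K′ v in K′v
...   | true  | true  = contradiction refl K≢K′
...   | false | false = contradiction refl K≢K′
...   | true  | false = ∈∖⇒swing G K K′ (isKSPartition⇒splits G K S ks)
                          (isKSPartition⇒splits G K′ S′ ks′) v Kv K′v
...   | false | true  = ∈∖⇒swing G K′ K (isKSPartition⇒splits G K′ S′ ks′)
                          (isKSPartition⇒splits G K S ks) v K′v Kv

-- Free choice of the neighbours of a swing vertex.

-- The positions where a swing vertex v may be rewired when it is put on the
-- clique side (c = true) or on the stable side (c = false).
free : Bool → Fin n → Subset n → Subset n
free false v K = K
free true  v K = ∁ (K [ v ]≔ true)

free-swing : ∀ c (v : Fin n) (K : Subset n) → lookup K v ≡ false → lookup (free c v K) v ≡ false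
free-swing false v K Kv = Kv
free-swing true  v K Kv = trans (lookup-map v not (K [ v ]≔ true)) (cong not (lookup∘update v K true))

free-own-side : ∀ c (v : Fin n) (K : Subset n) {j} → j ≢ v → lookup K j ≡ c →
  lookup (free c v K) j ≡ false
free-own-side false v K j≢v Kj = Kj
free-own-side true  v K {j} j≢v Kj = trans (lookup-map j not (K [ v ]≔ true))
  (cong not (trans (lookup∘update′ j≢v K true) Kj))

∣update∣≤ : (K : Subset n) (v : Fin n) → ∣ K [ v ]≔ true ∣ ≤ suc ∣ K ∣
∣update∣≤ (false ∷ K) zero    = ≤-refl
∣update∣≤ (true ∷ K)  zero    = n≤1+n _
∣update∣≤ (false ∷ K) (suc v) = ∣update∣≤ K v
∣update∣≤ (true ∷ K)  (suc v) = s≤s (∣update∣≤ K v)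

-- If `K` has fewer than `m` elements, then `K` together with `v` has at most `m`, which leaves at
-- least `n ∸ m`, hence at least `m`, other vertices.
free-large : (v : Fin n) (K : Subset n) → m + m ≤ n → ∃[ c ] m ≤ ∣ free c v K ∣
free-large {n} {m} v K 2m≤n with m ≤? ∣ K ∣
... | yes m≤∣K∣ = false , m≤∣K∣
... | no  m≰∣K∣ = true , (begin
  m                         ≤⟨ m+n≤o⇒m≤o∸n m 2m≤n ⟩
  n ∸ m                     ≤⟨ ∸-monoʳ-≤ n (≤-trans (∣update∣≤ K v) (≰⇒> m≰∣K∣)) ⟩
  n ∸ ∣ K [ v ]≔ true ∣     ≡⟨ ∣∁p∣≡n∸∣p∣ (K [ v ]≔ true) ⟨
  ∣ ∁ (K [ v ]≔ true) ∣     ∎)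
  where open ≤-Reasoning

-- Free positions are all on the side opposite to `v`, where `Splits` demands nothing. On the side
-- of `v` the row still agrees with `K`, whose value there is `c`, just as required.
rewire-splits : (G : Graph n) (K : Subset n) (v : Fin n) → IsSwing G K v → ∀ c (w : Vec Bool m) →
  Splits (K [ v ]≔ c) (rewire v (overwrite (free c v K) K w) G)
rewire-splits G K v (sp , _) c w = splits
  where
  r = overwrite (free c v K) K w
  H = rewire v r G
  K′ = K [ v ]≔ c
  K′v : lookup K′ v ≡ c
  K′v = lookup∘update v K c
  K′≢ : ∀ {j} → j ≢ v → lookup K′ j ≡ lookup K j
  K′≢ j≢v = lookup∘update′ j≢v K c
  row : ∀ {j} → j ≢ v → lookup K′ j ≡ c → edge H v j ≡ c
  row {j} j≢v K′j = trans (edge-rewire-row v r G j≢v)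
    (trans (lookup-overwrite (free c v K) K w j (free-own-side c v K j≢v Kj)) Kj)
    where Kj = trans (sym (K′≢ j≢v)) K′j
  splits : Splits K′ H
  splits {i} {j} i≢j eq with i ≟ᶠ v | j ≟ᶠ v
  ... | yes refl | _        = trans (row (i≢j ∘ sym) (trans (sym eq) K′v)) (sym K′v)
  ... | no  i≢v  | yes refl = trans (edge-sym H i v)
    (trans (row i≢v (trans eq K′v)) (sym (trans eq K′v)))
  ... | no  i≢v  | no  j≢v  = trans (edge-rewire-other v r G i≢v j≢v)
    (trans (sp i≢j (trans (sym (K′≢ i≢v)) (trans eq (K′≢ j≢v)))) (sym (K′≢ i≢v)))

-- KS-partitions of one graph are two changes apart.

Change : ℕ → Set
Change n = Fin n × Bool

_⟪_⟫ : Subset n → Change n → Subset n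
K ⟪ i , b ⟫ = K [ i ]≔ b

changes : ∀ n → List (Change n)
changes n = cartesianProduct (allFin n) bools

∈-changes : (d : Change n) → d ∈ˡ changes n
∈-changes (i , b) = ∈-cartesianProduct⁺ (∈-allFin i) (bools-complete b)

length-changes : ∀ n → length (changes n) ≡ n * 2
length-changes n = trans (length-cartesianProductWith _,_ (allFin n) bools)
  (cong (_* 2) (length-tabulate {n = n} (λ i → i)))

-- Two vertices that both move from one part to the other would have to be both
-- adjacent and non-adjacent.
splits-move-one : (G : Graph n) (K K′ : Subset n) → Splits K G → Splits K′ G → Fin n → ∀ b →
  ∃[ i ] ∀ k → lookup K k ≡ b → lookup K′ k ≢ b → k ≡ i
splits-move-one G K K′ sp sp′ v b
  with any? (λ k → (lookup K k ≟ᵇ b) ×-dec ¬? (lookup K′ k ≟ᵇ b))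
... | no  none           = v , λ k Kk K′k → contradiction (k , Kk , K′k) none
... | yes (i , Ki , K′i) = i , λ k Kk K′k → decidable-stable (k ≟ᶠ i) λ k≢i →
  K′k (trans (sym (sp′ k≢i (trans (¬-not K′k) (sym (¬-not K′i)))))
             (trans (sp k≢i (trans Kk (sym Ki))) Kk))

-- One change handles the vertex that leaves the clique, the other the vertex that enters it. If
-- there is no such vertex, the default `v` is used; this is harmless, since each change writes the
-- value that `K′` has anyway.
splits-two-changes : (G : Graph n) (K K′ : Subset n) → Splits K G → Splits K′ G → Fin n →
  ∃[ d ] ∃[ e ] K ⟪ d ⟫ ⟪ e ⟫ ≡ K′
splits-two-changes G K K′ sp sp′ v
  with i , only-i ← splits-move-one G K K′ sp sp′ v true
     | j , only-j ← splits-move-one G K K′ sp sp′ v false =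
  (i , lookup K′ i) , (j , lookup K′ j) , lookup-ext eq
  where
  K₁ = K [ i ]≔ lookup K′ i
  same : ∀ k → k ≢ i → k ≢ j → lookup K k ≡ lookup K′ k
  same k k≢i k≢j = decidable-stable (lookup K k ≟ᵇ lookup K′ k) λ K≢K′ →
    case (lookup K k ≟ᵇ true) K≢K′
    where
    case : Dec (lookup K k ≡ true) → lookup K k ≢ lookup K′ k → _
    case (yes Kk) K≢K′ = k≢i (only-i k Kk λ K′k → K≢K′ (trans Kk (sym K′k)))
    case (no ¬Kk) K≢K′ = k≢j (only-j k (¬-not ¬Kk) λ K′k → K≢K′ (trans (¬-not ¬Kk) (sym K′k)))
  eq : ∀ k → lookup (K₁ [ j ]≔ lookup K′ j) k ≡ lookup K′ k
  eq k with k ≟ᶠ j | k ≟ᶠ i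
  ... | yes refl | _        = lookup∘update k K₁ _
  ... | no  k≢j  | yes refl = trans (lookup∘update′ k≢j K₁ _) (lookup∘update k K _)
  ... | no  k≢j  | no  k≢i  = trans (lookup∘update′ k≢j K₁ _)
    (trans (lookup∘update′ k≢i K _) (same k k≢i k≢j))

-- Recovering the original graph and the chosen word.

-- The first two changes lead from `cliquePart` to the partition of the rewired graph; the third
-- records the swing vertex and its new side.
Code : ℕ → Set
Code n = Change n × Change n × Change n

codes : ∀ n → List (Code n)
codes n = cartesianProduct (changes n) (cartesianProduct (changes n) (changes n))

length-codes : ∀ n → length (codes n) ≡ (n * 2) ^ 3
length-codes n
  rewrite length-cartesianProductWith _,_ (changes n) (cartesianProduct (changes n) (changes n))
        | length-cartesianProductWith _,_ (changes n) (changes n)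
        | length-changes n | *-identityʳ (n * 2) = refl

decode : Graph n × Code n → Graph n × Vec Bool m
decode {m = m} (H , d , e , v , c) = rewire v K H , extract (free c v K) (lookup (matrix H) v) m
  -- Taking `v` out of the clique yields the original `K`, which by `IsSwing` is also the original
  -- row of `v`. One set thus serves to restore the graph and to locate the free positions.
  where K = cliquePart H ⟪ d ⟫ ⟪ e ⟫ [ v ]≔ false

IsDecoded : Graph n → Vec Bool m → Set
IsDecoded G w = ∃[ H ] ∃[ code ] IsSplit H × decode (H , code) ≡ (G , w)

swing⇒isDecoded : (G : Graph n) (K : Subset n) (v : Fin n) → IsSwing G K v →
  ∀ c (w : Vec Bool m) → m ≤ ∣ free c v K ∣ → IsDecoded G w
swing⇒isDecoded {n} {m} G K v swing@(_ , row) c w large =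
  from-changes (splits-two-changes H (cliquePart H) K′ (cliquePart-splits H split) splits v)
  where
  r = overwrite (free c v K) K w
  H = rewire v r G
  K′ = K [ v ]≔ c
  Kv : lookup K v ≡ false
  Kv = isSwing⇒∉ G K swing
  rv : lookup r v ≡ false
  rv = trans (lookup-overwrite (free c v K) K w v (free-swing c v K Kv)) Kv
  splits : Splits K′ H
  splits = rewire-splits G K v swing c w
  split : IsSplit H
  split = (K′ , ∁ K′) , splits⇒isKSPartition H K′ splits
  undo : K′ [ v ]≔ false ≡ K
  undo = trans ([]≔-idempotent K v) (trans (cong (K [ v ]≔_) (sym Kv)) ([]≔-lookup K v))
  from-changes : ∃[ d ] ∃[ e ] cliquePart H ⟪ d ⟫ ⟪ e ⟫ ≡ K′ → IsDecoded G w
  from-changes (d , e , eq) = H , (d , e , v , c) , split , trans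
    (cong (λ L → rewire v L H , extract (free c v L) (lookup (matrix H) v) m)
          (trans (cong (_[ v ]≔ false) eq) undo))
    (cong₂ _,_
      (trans (cong (λ L → rewire v L H) (sym row)) (rewire-restore v r G))
      (trans (cong (λ bs → extract (free c v K) bs m) (matrix-rewire-row v r G rv))
             (extract-overwrite (free c v K) K w large)))

unbalanced⇒isDecoded : (G : Graph n) → IsUnbalanced G → (w : Vec Bool m) → m + m ≤ n →
  IsDecoded G w
unbalanced⇒isDecoded G unbal w 2m≤n =
  let K , v , swing = unbalanced⇒swing G unbal
      c , large     = free-large v K 2m≤n
  in swing⇒isDecoded G K v swing c w large

-- The counting inequality.

-- The distinct pairs of an unbalanced graph and a word all occur among the images under `decode` of
-- pairs of a split graph and a code.
u*2^m≤s*[2n]³ : m + m ≤ n → u n * 2 ^ m ≤ s n * (n * 2) ^ 3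
u*2^m≤s*[2n]³ {m} {n} 2m≤n = begin
  u n * 2 ^ m                              ≡⟨ cong (u n *_) (length-vectors bools m) ⟨
  u n * length (vectors bools m)           ≡⟨ length-cartesianProductWith _,_ us (vectors bools m) ⟨
  length (cartesianProduct us (vectors bools m)) ≤⟨ unique-⊆⇒length≤ unique decodable ⟩
  length (map decode (cartesianProduct ss (codes n))) ≡⟨ length-map decode (cartesianProduct ss (codes n)) ⟩
  length (cartesianProduct ss (codes n))   ≡⟨ length-cartesianProductWith _,_ ss (codes n) ⟩
  s n * length (codes n)                   ≡⟨ cong (s n *_) (length-codes n) ⟩
  s n * (n * 2) ^ 3                        ∎
  where
  open ≤-Reasoning
  us = filter isUnbalanced? (graphs n)
  ss = filter isSplit? (graphs n)
  unique : Unique (cartesianProduct us (vectors bools m))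
  unique = Unique.cartesianProduct⁺ (Unique.filter⁺ isUnbalanced? (graphs-unique n))
    (vectors-unique bools-unique m)
  decoded : ∀ {G w} → IsDecoded G w → (G , w) ∈ˡ map decode (cartesianProduct ss (codes n))
  decoded (H , (d , e , f) , split , eq) = subst (_∈ˡ map decode (cartesianProduct ss (codes n))) eq
    (∈-map⁺ decode (∈-cartesianProduct⁺
      (∈-filter⁺ isSplit? (graphs-complete H) split)
      (∈-cartesianProduct⁺ (∈-changes d) (∈-cartesianProduct⁺ (∈-changes e) (∈-changes f)))))
  decodable : cartesianProduct us (vectors bools m) ⊆ map decode (cartesianProduct ss (codes n))
  decodable {G , w} G,w∈ = decoded (unbalanced⇒isDecoded G unbal w 2m≤n)
    where
    unbal = proj₂ (∈-filter⁻ isUnbalanced? {xs = graphs n}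
      (proj₁ (∈-cartesianProduct⁻ us (vectors bools m) G,w∈)))

-- Growth estimates and the limit.

n<2^n : ∀ n → n < 2 ^ n
n<2^n zero    = s≤s z≤n
n<2^n (suc n) = begin-strict
  suc n           ≤⟨ n<2^n n ⟩
  2 ^ n           <⟨ m<m+n (2 ^ n) (m^n>0 2 n) ⟩
  2 ^ n + 2 ^ n   ≡⟨ cong (λ t → 2 ^ n + t) (+-identityʳ (2 ^ n)) ⟨
  2 ^ suc n       ∎
  where open ≤-Reasoning

-- With `k = n div 8` and `m = k * 4`, the power `2 ^ m` is at least `suc k ^ 4`. Three of these
-- factors cancel against `(n * 2) ^ 3`, and the fourth remains.
u*[1+n/8]≤16³*s : ∀ n → u n * suc (n div 8) ≤ 16 ^ 3 * s n
u*[1+n/8]≤16³*s n = *-cancelʳ-≤ _ _ (suc k ^ 3) {{m^n≢0 (suc k) 3}} (begin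
  u n * suc k * suc k ^ 3     ≡⟨ *-assoc (u n) (suc k) (suc k ^ 3) ⟩
  u n * suc k ^ 4             ≤⟨ *-monoʳ-≤ (u n) (^-monoˡ-≤ 4 (n<2^n k)) ⟩
  u n * (2 ^ k) ^ 4           ≡⟨ cong (u n *_) (^-*-assoc 2 k 4) ⟩
  u n * 2 ^ (k * 4)           ≤⟨ u*2^m≤s*[2n]³ {m = k * 4} 8k≤n ⟩
  s n * (n * 2) ^ 3           ≤⟨ *-monoʳ-≤ (s n) (^-monoˡ-≤ 3 2n≤) ⟩
  s n * (16 * suc k) ^ 3      ≡⟨ solve 3 (λ a b c → a :* (c :* b) :^ 3 := c :^ 3 :* a :* b :^ 3)
                                   refl (s n) (suc k) 16 ⟩
  16 ^ 3 * s n * suc k ^ 3    ∎)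
  where
  open ≤-Reasoning
  open +-*-Solver
  k = n div 8
  8k≤n : k * 4 + k * 4 ≤ n
  8k≤n = subst (_≤ n) (*-distribˡ-+ k 4 4) (m/n*n≤m n 8)
  2n≤ : n * 2 ≤ 16 * suc k
  2n≤ = begin
    n * 2                     ≡⟨ cong (_* 2) (m≡m%n+[m/n]*n n 8) ⟩
    (n % 8 + k * 8) * 2       ≤⟨ *-monoˡ-≤ 2 (+-monoˡ-≤ (k * 8) (<⇒≤ (m%n<n n 8))) ⟩
    suc k * 8 * 2             ≡⟨ *-assoc (suc k) 8 2 ⟩
    suc k * 16                ≡⟨ *-comm (suc k) 16 ⟩
    16 * suc k                ∎

∣a/b∣<ε : ∀ a b .{{_ : NonZero b}} ε → 0ℚ ℚ.< ε → a * ↧ₙ ε < b →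
  ℚ.∣ + a / b ℚ.- 0ℚ ∣ ℚ.< ε
-- The numerator of a positive `ε` is at least 1, so it suffices to be below 1 over its denominator.
∣a/b∣<ε a b@(suc _) ε@(mkℚ (+ suc p) _ _) _ a*d<b = subst (ℚ._< ε) (sym ∣a/b∣≡)
  (ℚ.toℚᵘ-cancel-< (ℚᵘ.<-respˡ-≃ (ℚᵘ.≃-sym (ℚ.toℚᵘ-fromℚᵘ (ℚᵘ.mkℚᵘ (+ a) _)))
    (ℚᵘ.*<* (subst₂ ℤ._<_ (ℤ.pos-* a (↧ₙ ε)) (ℤ.pos-* (suc p) b)
      (+<+ (≤-trans a*d<b (m≤n*m b (suc p))))))))
  where
  ∣a/b∣≡ : ℚ.∣ + a / b ℚ.- 0ℚ ∣ ≡ + a / b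
  ∣a/b∣≡ = trans (cong ℚ.∣_∣ (ℚ.+-identityʳ (+ a / b)))
    (ℚ.0≤p⇒∣p∣≡p (ℚ.nonNegative⁻¹ (+ a / b) {{ℚ.normalize-nonNeg a b}}))
∣a/b∣<ε a b (mkℚ (+ zero) _ _)    (ℚ.*<* (+<+ ())) _
∣a/b∣<ε a b (mkℚ -[1+ _ ] _ _) (ℚ.*<* ()) _

-- For positive `a`, strictness comes from `k < suc k`; for `a = 0` it comes from `b` being nonzero.
*-cancel-slack : ∀ c a d k b .{{_ : NonZero c}} .{{_ : NonZero b}} →
  a * suc k ≤ c * b → c * d ≤ k → a * d < b
*-cancel-slack c zero      d k b _  _    = >-nonZero⁻¹ b
*-cancel-slack c a@(suc _) d k b le cd≤k = *-cancelˡ-< c _ _ (begin-strict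
  c * (a * d)   ≡⟨ solve 3 (λ x y z → x :* (y :* z) := y :* (x :* z)) refl c a d ⟩
  a * (c * d)   ≤⟨ *-monoʳ-≤ a cd≤k ⟩
  a * k         <⟨ *-monoʳ-< a (n<1+n k) ⟩
  a * suc k     ≤⟨ le ⟩
  c * b         ∎)
  where
  open ≤-Reasoning
  open +-*-Solver

theorem3p6 : Lim (λ n → _/_ (+ u n) (s n) {{s-nonZero n}}) 0ℚ
-- The factor 8 undoes the division: beyond this bound `n div 8` is at least `16 ^ 3 * ↧ₙ ε`.
theorem3p6 ε ε>0 = 16 ^ 3 * ↧ₙ ε * 8 , λ n n≥N →
  ∣a/b∣<ε (u n) (s n) {{s-nonZero n}} ε ε>0
    (*-cancel-slack (16 ^ 3) (u n) (↧ₙ ε) (n div 8) (s n) {{_}} {{s-nonZero n}} (u*[1+n/8]≤16³*s n)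
      (subst (_≤ n div 8) (m*n/n≡m (16 ^ 3 * ↧ₙ ε) 8) (/-monoˡ-≤ 8 n≥N)))
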